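{- Let $G=(V,E)$ be an undirected graph having a strongly connected orientation. A strongly connected orientation $D$ of $G$ is decreasingly minimal among the strongly connected orientations of $G$ if and only if there are no nodes $s,t$ with $\varrho_D(t)\ge\varrho_D(s)+2$ such that $D$ contains two arc-disjoint directed paths from $s$ to $t$.
   Context: $\varrho_D(v)$ is the number of arcs with head $v$. An orientation is decreasingly minimal among a class if its in-degree vector has largest component as small as possible within the class, then second largest as small as possible, and so on. -}

module Defs where

open import Data.Fin.Base using (Fin)
open import Data.Fin.Properties using (_≟_)
open import Data.List.Base using (List; []; _∷_; length; filter; map; allFin)
open import Data.List.Relation.Binary.Disjoint.Propositional using (Disjoint)
open import Data.List.Relation.Binary.Lex.Strict using (Lex-≤)
open import Data.List.Relation.Unary.Unique.Propositional using (Unique)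
open import Data.Nat.Base using (ℕ; _<_)
open import Data.Nat.Properties using (≤-decTotalOrder)
open import Data.Product.Base using (_×_; _,_; ∃; Σ-syntax; swap)
open import Data.Sum.Base using (_⊎_)
open import Relation.Binary.Construct.Flip.EqAndOrd using () renaming (decTotalOrder to flipOrder)
open import Relation.Binary.PropositionalEquality.Core using (_≡_)
import Data.List.Sort

-- Finite graphs with n nodes and m edges; parallel edges and loops are allowed.
-- The order of the two components of `ends e` carries no meaning.
record Graph (n m : ℕ) : Set where
  field
    ends : Fin m → Fin n × Fin n

record Digraph (n m : ℕ) : Set where
  field
    tail : Fin m → Fin n
    head : Fin m → Fin n

module _ {n m : ℕ} where

  -- The arc obtained by orienting edge e keeps the index e.
  IsOrientation : Graph n m → Digraph n m → Set
  IsOrientation G D =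
    ∀ e → (tail e , head e) ≡ ends e ⊎ (tail e , head e) ≡ swap (ends e)
    where
    open Graph G
    open Digraph D

  module _ (D : Digraph n m) where
    open Digraph D

    data Walk : Fin n → Fin n → Set where
      done : ∀ {u} → Walk u u
      step : ∀ {u v} (e : Fin m) → tail e ≡ u → Walk (head e) v → Walk u v

  module _ {D : Digraph n m} where

    arcs : ∀ {u v} → Walk D u v → List (Fin m)
    arcs done         = []
    arcs (step e _ w) = e ∷ arcs w

    nodes : ∀ {u v} → Walk D u v → List (Fin n)
    nodes {u} done         = u ∷ []
    nodes {u} (step _ _ w) = u ∷ nodes w

  Path : Digraph n m → Fin n → Fin n → Set
  Path D u v = Σ[ w ∈ Walk D u v ] Unique (nodes w)

  ArcDisjoint : ∀ {D : Digraph n m} {s t} → Path D s t → Path D s t → Set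
  ArcDisjoint (p , _) (q , _) = Disjoint (arcs p) (arcs q)

  StronglyConnected : Digraph n m → Set
  StronglyConnected D = ∀ u v → Path D u v

  IsStrongOrientation : Graph n m → Digraph n m → Set
  IsStrongOrientation G D = IsOrientation G D × StronglyConnected D

  HasStrongOrientation : Graph n m → Set
  HasStrongOrientation G = ∃ (IsStrongOrientation G)

  inDegree : Digraph n m → Fin n → ℕ
  inDegree D v = length (filter (λ e → Digraph.head D e ≟ v) (allFin m))

  inDegreeVector : Digraph n m → List ℕ
  inDegreeVector D = map (inDegree D) (allFin n)

sortDecreasing : List ℕ → List ℕ
sortDecreasing = Data.List.Sort.sort (flipOrder ≤-decTotalOrder)

-- Lexicographic comparison of the decreasing rearrangements.
_≤dec_ : List ℕ → List ℕ → Set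
xs ≤dec ys = Lex-≤ _≡_ _<_ (sortDecreasing xs) (sortDecreasing ys)

DecMinAmong : ∀ {n m} → (Digraph n m → Set) → Digraph n m → Set
DecMinAmong C D = C D × (∀ D′ → C D′ → inDegreeVector D ≤dec inDegreeVector D′)

{-# OPTIONS --safe #-}
module Submission where

-- For decreasingly sorted x, x′ of equal length, the lexicographic order is implied by
-- Σ_v max(x(v) − j, 0) ≤ Σ_v max(x′(v) − j, 0) for all j.
--
-- Necessity: reversing one of two arc-disjoint s–t paths keeps D strong, as the other path
-- restores the lost connections, and it moves one unit of in-degree from t to s, which
-- lowers such a sum strictly.
--
-- Sufficiency: for the in-degree vector x of D, let U be the set of nodes s from
-- which some t with x(t) > j cannot be separated by a set of in-degree at most 1.  By Menger's theorem and the hypothesis, x ≥ j on U and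
-- x ≤ j off U.  The sets of in-degree 1 form a crossing family, and x(X) ≤ x′(X) for such X and
-- the in-degree vector x′ of any strong orientation.  Uncrossing writes U as a disjoint union
-- of sets, each an intersection of such X with pairwise disjoint complements, so by modularity
-- x(U) ≤ x′(U), which yields the inequality above.

open import Defs
import Algebra.Properties.CommutativeMonoid.Sum
import Algebra.Properties.Semiring.Sum
open import Data.Bool.Base using (Bool; true; false; if_then_else_; _∧_; _∨_; not)
open import Data.Fin.Base using (Fin; zero; suc)
open import Data.Fin.Properties using (_≟_; any?; all?; ¬∀⟶∃¬)
open import Data.Fin.Subset using (Subset; _∈_; _∉_; _⊆_; _⊃_; ⁅_⁆; _∩_; _∪_; ⊤; ⊥; Nonempty)
open import Data.Fin.Subset.Induction using (⊃-wellFounded; Acc; acc)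
open import Data.Fin.Subset.Properties
open import Data.List.Base using (List; []; _∷_; length; filter; map; allFin; tabulate)
import Data.List.Membership.DecPropositional as DecMembership
open import Data.List.Membership.Propositional using () renaming (_∈_ to _∈ₗ_; _∉_ to _∉ₗ_)
open import Data.List.Membership.Propositional.Properties using (∈-allFin)
open import Data.List.Properties using (map-tabulate; map-∘; length-map)
open import Data.List.Relation.Binary.Lex.Strict using (Lex-≤; base; this; next; ≤-antisymmetric)
open import Data.List.Relation.Binary.Permutation.Propositional using (_↭_; ↭-sym)
open import Data.List.Relation.Binary.Permutation.Propositional.Properties using (map⁺; ↭-length)
open import Data.List.Relation.Binary.Pointwise using (Pointwise-≡⇒≡)
open import Data.List.Relation.Unary.All as All using (All; []; _∷_)
open import Data.List.Relation.Unary.All.Properties using (¬Any⇒All¬)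
open import Data.List.Relation.Unary.AllPairs using (AllPairs; []; _∷_)
open import Data.List.Relation.Unary.Any using (here; there)
open import Data.List.Relation.Unary.Sorted.TotalOrder.Properties using (Sorted⇒AllPairs)
open import Data.List.Relation.Unary.Unique.Propositional using (Unique)
import Data.List.Sort
open import Data.Nat.Base using (ℕ; zero; suc; _+_; _*_; _∸_; _≤_; _<_; _≥_; z≤n; s≤s)
open import Data.Nat.ListAction using (sum)
open import Data.Nat.ListAction.Properties using (sum-↭)
open import Data.Nat.Properties hiding (_≟_)
open import Data.Nat.Tactic.RingSolver using (solve-∀)
open import Data.Product.Base using (_×_; _,_; ∃; ∃₂; Σ-syntax; proj₁; proj₂; swap)
open import Data.Sum.Base using (_⊎_; inj₁; inj₂; [_,_]′)
open import Data.Unit.Base using (tt) renaming (⊤ to Unit)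
import Data.Vec.Base as Vec
open import Data.Vec.Properties using (lookup-zipWith; []=⇒lookup; lookup⇒[]=; lookup∘tabulate)
open import Function.Base using (_∘_; id; case_of_)
open import Function.Bundles using (_⇔_; mk⇔)
open import Relation.Binary.Construct.Flip.EqAndOrd using () renaming (decTotalOrder to flipOrder)
open import Relation.Binary.Bundles using (DecTotalOrder)
open import Relation.Binary.Definitions using (tri<; tri≈; tri>)
open import Relation.Binary.PropositionalEquality
  using (_≡_; _≢_; refl; sym; trans; cong; cong₂; subst; subst₂; module ≡-Reasoning)
open import Relation.Nullary using (Dec; yes; no; does; contradiction; ¬?; _×-dec_)
open import Relation.Nullary.Decidable using (dec-true; dec-false; decidable-stable)
open import Relation.Nullary.Negation.Core using (¬_)
open import Relation.Unary using (Pred; Decidable)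

open Algebra.Properties.CommutativeMonoid.Sum +-0-commutativeMonoid
  using (∑-distrib-+; ∑-comm; sum-cong-≗; sum-replicate-zero) renaming (sum to ∑)
open Algebra.Properties.Semiring.Sum +-*-semiring using (*-distribˡ-sum)

-- Sums over finite sets

∑-mono-≤ : ∀ {n} {f g : Fin n → ℕ} → (∀ i → f i ≤ g i) → ∑ f ≤ ∑ g
∑-mono-≤ {zero}  f≤g = z≤n
∑-mono-≤ {suc n} f≤g = +-mono-≤ (f≤g zero) (∑-mono-≤ (f≤g ∘ suc))

-- Both sides are the sum over the indices other than `i` plus `f i + g i`; crossing the two values
-- avoids truncated subtraction.
∑-exchange : ∀ {n} (f g : Fin n → ℕ) i → (∀ j → j ≢ i → f j ≡ g j) → ∑ f + g i ≡ ∑ g + f i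
∑-exchange f g zero f≗g
  rewrite sum-cong-≗ {x = f ∘ suc} {g ∘ suc} (λ j → f≗g (suc j) λ ()) =
  lemma (f zero) (∑ (g ∘ suc)) (g zero)
  where
  lemma : ∀ a b c → a + b + c ≡ c + b + a
  lemma = solve-∀
∑-exchange f g (suc i) f≗g
  rewrite f≗g zero (λ ())
        | +-assoc (g zero) (∑ (f ∘ suc)) (g (suc i))
        | +-assoc (g zero) (∑ (g ∘ suc)) (f (suc i)) =
  cong (g zero +_) (∑-exchange (f ∘ suc) (g ∘ suc) i λ j j≢i → f≗g (suc j) λ { refl → j≢i refl })

⟦_⟧ : Bool → ℕ
⟦ b ⟧ = if b then 1 else 0

δ : ∀ {n} → Fin n → Fin n → ℕ
δ u v = ⟦ does (u ≟ v) ⟧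

δ-≡ : ∀ {n} (u : Fin n) → δ u u ≡ 1
δ-≡ u = cong ⟦_⟧ (dec-true (u ≟ u) refl)

δ-≢ : ∀ {n} {u v : Fin n} → u ≢ v → δ u v ≡ 0
δ-≢ {u = u} {v} u≢v = cong ⟦_⟧ (dec-false (u ≟ v) u≢v)

∑-pick : ∀ {n} (f : Fin n → ℕ) u → ∑ (λ v → f v * δ u v) ≡ f u
∑-pick {n} f u = begin
  ∑ g                      ≡⟨ +-identityʳ _ ⟨
  ∑ g + 0                  ≡⟨ ∑-exchange g (λ _ → 0) u off ⟩
  ∑ {n} (λ _ → 0) + f u * δ u u
    ≡⟨ cong₂ _+_ (sum-replicate-zero n) (trans (cong (f u *_) (δ-≡ u)) (*-identityʳ _)) ⟩
  f u                      ∎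
  where
  open ≡-Reasoning
  g = λ v → f v * δ u v
  off : ∀ v → v ≢ u → f v * δ u v ≡ 0
  off v v≢u = trans (cong (f v *_) (δ-≢ (v≢u ∘ sym))) (*-zeroʳ (f v))

∑-δ : ∀ {n} (u : Fin n) → ∑ (δ u) ≡ 1
∑-δ u = trans (sum-cong-≗ (λ v → sym (*-identityˡ (δ u v)))) (∑-pick (λ _ → 1) u)

sum-tabulate : ∀ {n} (f : Fin n → ℕ) → sum (tabulate f) ≡ ∑ f
sum-tabulate {zero}  f = refl
sum-tabulate {suc n} f = cong (f zero +_) (sum-tabulate (f ∘ suc))

sum-map-allFin : ∀ {n} (f : Fin n → ℕ) → sum (map f (allFin n)) ≡ ∑ f
sum-map-allFin f = trans (cong sum (map-tabulate id f)) (sum-tabulate f)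

length-filter-sum : ∀ {a p} {A : Set a} {P : Pred A p} (P? : Decidable P) xs →
  length (filter P? xs) ≡ sum (map (λ x → ⟦ does (P? x) ⟧) xs)
length-filter-sum P? []       = refl
length-filter-sum P? (x ∷ xs) with does (P? x)
... | true  = cong suc (length-filter-sum P? xs)
... | false = length-filter-sum P? xs

-- Decreasing order

-- Since `_∸_` truncates at zero, this is the sum of the positive parts max(x - j, 0), the test
-- functions of weak majorization.
hinge : ℕ → List ℕ → ℕ
hinge j xs = sum (map (_∸ j) xs)

hinge-above : ∀ {y ys} → All (_≤ y) ys → hinge y ys ≡ 0
hinge-above []         = refl
hinge-above (z≤y ∷ zs) = cong₂ _+_ (m≤n⇒m∸n≡0 z≤y) (hinge-above zs)

hinge-↭ : ∀ j {xs ys} → xs ↭ ys → hinge j xs ≡ hinge j ys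
hinge-↭ j p = sum-↭ (map⁺ (_∸ j) p)

-- Equal heads cancel at every level. At the first difference `x > y` is impossible: at level `y`
-- the right sum vanishes, whereas `x` contributes `x ∸ y`.
lex-of-hinges : ∀ {xs ys} → AllPairs _≥_ xs → AllPairs _≥_ ys → length xs ≡ length ys →
  (∀ j → hinge j xs ≤ hinge j ys) → Lex-≤ _≡_ _<_ xs ys
lex-of-hinges []         []         len h = base tt
lex-of-hinges {x ∷ xs} {y ∷ ys} (_ ∷ ps) (q ∷ qs) len h with <-cmp x y
... | tri< x<y _ _ = this x<y
... | tri≈ _ refl _ =
  next refl (lex-of-hinges ps qs (suc-injective len) λ j → +-cancelˡ-≤ (x ∸ j) _ _ (h j))
... | tri> _ _ y<x = contradiction (h y) (<⇒≱ (begin-strict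
  hinge y (y ∷ ys)  ≡⟨ hinge-above (≤-refl ∷ q) ⟩
  0                 <⟨ m<n⇒0<n∸m y<x ⟩
  x ∸ y             ≤⟨ m≤m+n _ _ ⟩
  hinge y (x ∷ xs)  ∎))
  where open ≤-Reasoning

module _ where
  private
    O = flipOrder ≤-decTotalOrder
    module S = Data.List.Sort O

  sortDecreasing-↭ : ∀ xs → sortDecreasing xs ↭ xs
  sortDecreasing-↭ = S.sort-↭

  sortDecreasing-≥ : ∀ xs → AllPairs _≥_ (sortDecreasing xs)
  sortDecreasing-≥ xs = Sorted⇒AllPairs (DecTotalOrder.totalOrder O) (S.sort-↗ xs)

≤dec-of-hinges : ∀ {xs ys} → length xs ≡ length ys →
  (∀ j → hinge j xs ≤ hinge j ys) → xs ≤dec ys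
≤dec-of-hinges {xs} {ys} len h =
  lex-of-hinges (sortDecreasing-≥ xs) (sortDecreasing-≥ ys)
    (trans (↭-length (sortDecreasing-↭ xs)) (trans len (sym (↭-length (sortDecreasing-↭ ys)))))
    λ j → subst₂ _≤_ (hinge-↭ j (↭-sym (sortDecreasing-↭ xs)))
                     (hinge-↭ j (↭-sym (sortDecreasing-↭ ys))) (h j)

-- Antisymmetry identifies only the sorted lists, but these sums are invariant under permutation.
≤dec-antisym-hinge : ∀ {xs ys} → xs ≤dec ys → ys ≤dec xs → ∀ j → hinge j xs ≡ hinge j ys
≤dec-antisym-hinge {xs} {ys} xs≤ys ys≤xs j = begin
  hinge j xs                   ≡⟨ hinge-↭ j (sortDecreasing-↭ xs) ⟨
  hinge j (sortDecreasing xs)  ≡⟨ cong (hinge j) same ⟩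
  hinge j (sortDecreasing ys)  ≡⟨ hinge-↭ j (sortDecreasing-↭ ys) ⟩
  hinge j ys                   ∎
  where
  open ≡-Reasoning
  same : sortDecreasing xs ≡ sortDecreasing ys
  same = Pointwise-≡⇒≡ (≤-antisymmetric sym (λ { refl → <-irrefl refl }) <-asym xs≤ys ys≤xs)

-- Uncrossing

-- The two closure conditions make `T` a crossing family; it is later the family of sets of
-- in-degree at most 1 in a strong digraph.
module Uncross {n : ℕ} (T : Subset n → Set)
  (T-∩ : ∀ {X Y} → T X → T Y → Nonempty (X ∩ Y) → (∃ λ v → v ∉ X ∪ Y) → T (X ∩ Y))
  (T-∪ : ∀ {X Y} → T X → T Y → Nonempty (X ∩ Y) → (∃ λ v → v ∉ X ∪ Y) → T (X ∪ Y)) where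

  Covers : Subset n → Subset n → Set
  Covers X Y = ∀ v → v ∈ X ∪ Y

  covers? : ∀ X Y → Covers X Y ⊎ (∃ λ v → v ∉ X ∪ Y)
  covers? X Y with all? (λ v → v ∈? X ∪ Y)
  ... | yes c = inj₁ c
  ... | no ¬c = inj₂ (¬∀⟶∃¬ n (_∈ X ∪ Y) (_∈? X ∪ Y) ¬c)

  -- Intersections of members of T with pairwise disjoint complements.
  data Meet : Subset n → Set where
    whole : Meet ⊤
    meet  : ∀ {Z X} → Meet Z → T X → Covers Z X → Meet (Z ∩ X)

  Covers-∩ˡ : ∀ {X X′ Y} → Covers X Y → Covers X′ Y → Covers (X ∩ X′) Y
  Covers-∩ˡ {X} {X′} {Y} c c′ v with x∈p∪q⁻ X Y (c v) | x∈p∪q⁻ X′ Y (c′ v)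
  ... | inj₁ p | inj₁ q = x∈p∪q⁺ (inj₁ (x∈p∩q⁺ (p , q)))
  ... | inj₂ p | _      = x∈p∪q⁺ (inj₂ p)
  ... | _      | inj₂ q = x∈p∪q⁺ (inj₂ q)

  Nonempty-mono : ∀ {X Y : Subset n} → X ⊆ Y → Nonempty X → Nonempty Y
  Nonempty-mono X⊆Y (v , v∈X) = v , X⊆Y v∈X

  ∩-monoˡ : ∀ {X X′} (Y : Subset n) → X ⊆ X′ → X ∩ Y ⊆ X′ ∩ Y
  ∩-monoˡ {X} Y X⊆X′ v∈ = let p , q = x∈p∩q⁻ X Y v∈ in x∈p∩q⁺ (X⊆X′ p , q)

  -- Induction on the meet. If the complements of `X` and the last member `Y` are disjoint, `X` is
  -- pushed past `Y`; otherwise the two cross and are replaced by their intersection, again in `T`.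
  Meet-∩ : ∀ {Z X} → Meet Z → T X → Nonempty (Z ∩ X) → Meet (Z ∩ X)
  Meet-∩ whole tX _ = meet whole tX λ v → x∈p∪q⁺ (inj₁ ∈⊤)
  Meet-∩ {X = X} (meet {Z} {Y} mZ tY c) tX ne with covers? X Y
  ... | inj₁ c′ = subst Meet eq
      (meet (Meet-∩ mZ tX (Nonempty-mono (∩-monoˡ X (p∩q⊆p Z Y)) ne)) tY (Covers-∩ˡ c c′))
    where
    eq : (Z ∩ X) ∩ Y ≡ (Z ∩ Y) ∩ X
    eq = trans (∩-assoc Z X Y) (trans (cong (Z ∩_) (∩-comm X Y)) (sym (∩-assoc Z Y X)))
  ... | inj₂ v∉ = subst Meet eq (Meet-∩ mZ (T-∩ tX tY ne′ v∉) (subst Nonempty (sym eq) ne))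
    where
    eq : Z ∩ (X ∩ Y) ≡ (Z ∩ Y) ∩ X
    eq = trans (cong (Z ∩_) (∩-comm X Y)) (sym (∩-assoc Z Y X))
    ne′ : Nonempty (X ∩ Y)
    ne′ = Nonempty-mono (p∩q⊆q Z (X ∩ Y)) (subst Nonempty (sym eq) ne)

  -- The union distributes over the last intersection. The factor `Y ∪ X` is either everything, and
  -- drops out, or again a member of `T`.
  Meet-∪-T : ∀ {Z X} → Meet Z → T X → Nonempty (Z ∩ X) → Meet (Z ∪ X)
  Meet-∪-T {X = X} whole tX _ = subst Meet (sym (∪-zeroˡ X)) whole
  Meet-∪-T {X = X} (meet {Z} {Y} mZ tY c) tX ne
    with covers? Y X | Meet-∪-T mZ tX (Nonempty-mono (∩-monoˡ X (p∩q⊆p Z Y)) ne)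
  ... | inj₁ c′ | m = subst Meet eq m
    where
    eq : Z ∪ X ≡ (Z ∩ Y) ∪ X
    eq = ⊆-antisym
      (λ {v} v∈ → [ (λ v∈Z → [ (λ v∈Y → x∈p∪q⁺ (inj₁ (x∈p∩q⁺ (v∈Z , v∈Y))))
                             , (λ v∈X → x∈p∪q⁺ (inj₂ v∈X)) ]′ (x∈p∪q⁻ Y X (c′ v)))
                  , (λ v∈X → x∈p∪q⁺ (inj₂ v∈X)) ]′ (x∈p∪q⁻ Z X v∈))
      (λ v∈ → [ (λ v∈Z∩Y → x∈p∪q⁺ (inj₁ (p∩q⊆p Z Y v∈Z∩Y)))
              , (λ v∈X → x∈p∪q⁺ (inj₂ v∈X)) ]′ (x∈p∪q⁻ (Z ∩ Y) X v∈))
  ... | inj₂ v∉ | m = subst Meet (sym (∪-distribʳ-∩ X Z Y))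
      (meet m (T-∪ tY tX (Nonempty-mono (∩-monoˡ X (p∩q⊆q Z Y)) ne) v∉)
        λ v → [ (λ v∈Z → x∈p∪q⁺ (inj₁ (x∈p∪q⁺ (inj₁ v∈Z))))
              , (λ v∈Y → x∈p∪q⁺ (inj₂ (x∈p∪q⁺ (inj₁ v∈Y)))) ]′ (x∈p∪q⁻ Z Y (c v)))

  -- `Z` covers together with `Z′ ∩ X`, hence with each of `Z′` and `X`, so the members of the
  -- second meet can be appended one at a time.
  Meet-∩-Covers : ∀ {Z Z′} → Meet Z → Meet Z′ → Covers Z Z′ → Meet (Z ∩ Z′)
  Meet-∩-Covers {Z} mZ whole c = subst Meet (sym (∩-identityʳ Z)) mZ
  Meet-∩-Covers {Z} mZ (meet {Z′} {X} mZ′ tX c′) c =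
    subst Meet (∩-assoc Z Z′ X)
      (meet (Meet-∩-Covers mZ mZ′ (weaken (p∩q⊆p Z′ X))) tX
        (Covers-∩ˡ (weaken (p∩q⊆q Z′ X)) c′))
    where
    weaken : ∀ {Y} → Z′ ∩ X ⊆ Y → Covers Z Y
    weaken ⊆Y v = [ (λ p → x∈p∪q⁺ (inj₁ p)) , (λ q → x∈p∪q⁺ (inj₂ (⊆Y q))) ]′
      (x∈p∪q⁻ Z (Z′ ∩ X) (c v))

  -- By distributivity the union is the intersection of `Z ∪ Z′` and `Z ∪ X`. Both are meets because
  -- `v` is a common point, and they cover because `Z′` and `X` do.
  Meet-∪ : ∀ {Z Z′} → Meet Z → Meet Z′ → Nonempty (Z ∩ Z′) → Meet (Z ∪ Z′)
  Meet-∪ {Z} mZ whole _ = subst Meet (sym (∪-zeroʳ Z)) whole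
  Meet-∪ {Z} mZ (meet {Z′} {X} mZ′ tX c) (v , v∈) = subst Meet (sym (∪-distribˡ-∩ Z Z′ X))
    (Meet-∩-Covers
      (Meet-∪ mZ mZ′ (v , x∈p∩q⁺ (v∈Z , p∩q⊆p Z′ X v∈Z′∩X)))
      (Meet-∪-T mZ tX (v , x∈p∩q⁺ (v∈Z , p∩q⊆q Z′ X v∈Z′∩X)))
      λ w → [ (λ p → x∈p∪q⁺ (inj₁ (x∈p∪q⁺ (inj₂ p))))
            , (λ q → x∈p∪q⁺ (inj₂ (x∈p∪q⁺ (inj₂ q)))) ]′ (x∈p∪q⁻ Z′ X (c w)))
    where
    v∈Z = proj₁ (x∈p∩q⁻ Z (Z′ ∩ X) v∈)
    v∈Z′∩X = proj₂ (x∈p∩q⁻ Z (Z′ ∩ X) v∈)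

  data Join : Subset n → Set where
    none : Join ⊥
    join : ∀ {Y Z} → Join Y → Meet Z → ¬ Nonempty (Y ∩ Z) → Join (Y ∪ Z)

  -- A component that intersects the new meet is merged into it; a component disjoint from it is
  -- kept.
  Join-∪ : ∀ {Y Z} → Join Y → Meet Z → Join (Y ∪ Z)
  Join-∪ {Z = Z} none mZ = join none mZ λ (v , v∈) → ∉⊥ (proj₁ (x∈p∩q⁻ ⊥ Z v∈))
  Join-∪ {Z = Z} (join {Y} {Z₁} jY mZ₁ dis) mZ with nonempty? (Z₁ ∩ Z)
  ... | yes ne = subst Join (sym (∪-assoc Y Z₁ Z)) (Join-∪ jY (Meet-∪ mZ₁ mZ ne))
  ... | no ¬ne = subst Join eq (join (Join-∪ jY mZ) mZ₁ dis′)
    where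
    eq : (Y ∪ Z) ∪ Z₁ ≡ (Y ∪ Z₁) ∪ Z
    eq = trans (∪-assoc Y Z Z₁) (trans (cong (Y ∪_) (∪-comm Z Z₁)) (sym (∪-assoc Y Z₁ Z)))
    dis′ : ¬ Nonempty ((Y ∪ Z) ∩ Z₁)
    dis′ (v , v∈) with x∈p∩q⁻ (Y ∪ Z) Z₁ v∈
    ... | v∈Y∪Z , v∈Z₁ = [ (λ p → dis (v , x∈p∩q⁺ (p , v∈Z₁)))
                         , (λ q → ¬ne (v , x∈p∩q⁺ (v∈Z₁ , q))) ]′ (x∈p∪q⁻ Y Z v∈Y∪Z)

  module _ {U : Subset n}
    (separate : ∀ {s t} → t ∈ U → s ∉ U → ∃ λ X → T X × t ∈ X × s ∉ X) where

    -- One separating member of `T` is intersected for each listed node outside `U`; the common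
    -- point `t` keeps all these intersections nonempty.
    Meet-between : ∀ {t} → t ∈ U → ∀ ss →
      ∃ λ Z → Meet Z × t ∈ Z × (∀ {s} → s ∈ₗ ss → s ∉ U → s ∉ Z)
    Meet-between t∈U [] = ⊤ , whole , ∈⊤ , λ ()
    Meet-between t∈U (s ∷ ss) with Meet-between t∈U ss | s ∈? U
    ... | Z , mZ , t∈Z , avoid | yes s∈U =
      Z , mZ , t∈Z , λ { (here refl) s∉U → contradiction s∈U s∉U ; (there r∈) → avoid r∈ }
    ... | Z , mZ , t∈Z , avoid | no s∉U with separate t∈U s∉U
    ...   | X , tX , t∈X , s∉X =
      Z ∩ X , Meet-∩ mZ tX (_ , x∈p∩q⁺ (t∈Z , t∈X)) , x∈p∩q⁺ (t∈Z , t∈X) ,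
      λ { (here refl) _ → s∉X ∘ p∩q⊆q Z X ; (there r∈) r∉U → avoid r∈ r∉U ∘ p∩q⊆p Z X }

    Join-between : ∀ ts → ∃ λ Y → Join Y × Y ⊆ U × (∀ {t} → t ∈ₗ ts → t ∈ U → t ∈ Y)
    Join-between [] = ⊥ , none , (λ v∈ → contradiction v∈ ∉⊥) , λ ()
    Join-between (t ∷ ts) with Join-between ts | t ∈? U
    ... | Y , jY , Y⊆U , cov | no t∉U =
      Y , jY , Y⊆U , λ { (here refl) t∈U → contradiction t∈U t∉U ; (there r∈) → cov r∈ }
    -- With all nodes listed, the meet avoids the whole complement of `U` and so lies inside `U`.
    ... | Y , jY , Y⊆U , cov | yes t∈U with Meet-between t∈U (allFin n)
    ...   | Z , mZ , t∈Z , avoid =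
      Y ∪ Z , Join-∪ jY mZ ,
      (λ {v} v∈ → [ Y⊆U
                  , (λ v∈Z → decidable-stable (v ∈? U) λ v∉U → avoid (∈-allFin v) v∉U v∈Z) ]′
                  (x∈p∪q⁻ Y Z v∈)) ,
      λ { (here refl) _ → x∈p∪q⁺ (inj₂ t∈Z) ; (there r∈) r∈U → x∈p∪q⁺ (inj₁ (cov r∈ r∈U)) }

    separated⇒Join : Join U
    separated⇒Join with Join-between (allFin n)
    ... | Y , jY , Y⊆U , cov = subst Join (⊆-antisym Y⊆U λ {v} → cov (∈-allFin v)) jY

  -- An induction principle that asks for closure in just the two cases where an inequality between
  -- modular functions of equal total passes to the intersection or the union.
  module _ (P : Subset n → Set) (T⊆P : ∀ {X} → T X → P X) (P-⊤ : P ⊤) (P-⊥ : P ⊥)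
    (P-∩ : ∀ {X Y} → P X → P Y → Covers X Y → P (X ∩ Y))
    (P-∪ : ∀ {X Y} → P X → P Y → ¬ Nonempty (X ∩ Y) → P (X ∪ Y)) where

    Meet⊆P : ∀ {Z} → Meet Z → P Z
    Meet⊆P whole          = P-⊤
    Meet⊆P (meet mZ tX c) = P-∩ (Meet⊆P mZ) (T⊆P tX) c

    Join⊆P : ∀ {Y} → Join Y → P Y
    Join⊆P none            = P-⊥
    Join⊆P (join jY mZ dis) = P-∪ (Join⊆P jY) (Meet⊆P mZ) dis

-- Walks

module _ {n m : ℕ} where

  module _ {D : Digraph n m} where
    open Digraph D

    _++ʷ_ : ∀ {u v w} → Walk D u v → Walk D v w → Walk D u w
    done        ++ʷ q = q
    step e eq p ++ʷ q = step e eq (p ++ʷ q)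

    arc : ∀ e → Walk D (tail e) (head e)
    arc e = step e refl done

    suffix : ∀ {ℓ} {A : Pred (Fin m) ℓ} {u v x} (w : Walk D u v) → Unique (nodes w) →
      All A (arcs w) → x ∈ₗ nodes w → Σ[ P ∈ Path D x v ] All A (arcs (proj₁ P))
    suffix done          uniq         as (here refl) = (done , uniq) , as
    suffix w@(step _ _ _) uniq        as (here refl) = (w , uniq) , as
    suffix (step e eq w) (_ ∷ uniq) (_ ∷ as) (there x∈) = suffix w uniq as x∈

    open DecMembership (_≟_ {n}) using () renaming (_∈?_ to _∈ₗ?_)

    -- The predicate `A` is carried along so that avoidance of given arcs survives the removal of
    -- cycles.
    walk⇒path : ∀ {ℓ} {A : Pred (Fin m) ℓ} {u v} (w : Walk D u v) → All A (arcs w) →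
      Σ[ P ∈ Path D u v ] All A (arcs (proj₁ P))
    walk⇒path done as = (done , [] ∷ []) , as
    walk⇒path {u = u} (step e eq w) (a ∷ as) with walk⇒path w as
    ... | (p , uniq) , as′ with u ∈ₗ? nodes p
    ...   | yes u∈ = suffix p uniq as′ u∈
    ...   | no u∉  = (step e eq p , ¬Any⇒All¬ _ u∉ ∷ uniq) , a ∷ as′

    tail∈nodes : ∀ {u v e} (w : Walk D u v) → e ∈ₗ arcs w → tail e ∈ₗ nodes w
    tail∈nodes (step _ eq w) (here refl) = here eq
    tail∈nodes (step _ eq w) (there e∈)  = there (tail∈nodes w e∈)

    unique-arcs : ∀ {u v} (w : Walk D u v) → Unique (nodes w) → Unique (arcs w)
    unique-arcs done uniq = []
    unique-arcs (step e refl w) (u∉ ∷ uniq) =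
      All.tabulate (λ { e′∈ refl → All.lookup u∉ (tail∈nodes w e′∈) refl }) ∷ unique-arcs w uniq

    walk-enters : ∀ {u v} {X : Subset n} → Walk D u v → u ∉ X → v ∈ X →
      ∃ λ e → tail e ∉ X × head e ∈ X
    walk-enters done u∉ v∈ = contradiction v∈ u∉
    walk-enters {X = X} (step e refl w) u∉ v∈ with head e ∈? X
    ... | yes h∈ = e , u∉ , h∈
    ... | no h∉  = walk-enters w h∉ v∈

    module _ {ℓ} {A : Pred (Fin m) ℓ} (A? : Decidable A) where
      private
        WalkIn : Fin n → Fin n → Set ℓ
        WalkIn u v = Σ[ w ∈ Walk D u v ] All A (arcs w)

        Closed : Subset n → Set ℓ
        Closed X = ∀ e → A e → head e ∈ X → tail e ∈ X

        -- Backward search from `t`: tails of admissible entering arcs are added until none is left.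
        -- Each addition enlarges the set strictly, so the search ends.
        grow : ∀ t X → Acc _⊃_ X → t ∈ X → (∀ {u} → u ∈ X → WalkIn u t) →
          ∃ λ Y → t ∈ Y × (∀ {u} → u ∈ Y → WalkIn u t) × Closed Y
        grow t X (acc rec) t∈X walks
          with any? (λ e → A? e ×-dec (head e ∈? X) ×-dec ¬? (tail e ∈? X))
        ... | no none = X , t∈X , walks ,
          λ e a h∈ → decidable-stable (tail e ∈? X) λ t∉ → none (e , a , h∈ , t∉)
        ... | yes (e , a , h∈ , t∉) =
          grow t (X ∪ ⁅ tail e ⁆)
            (rec (p⊆p∪q ⁅ tail e ⁆ , tail e , x∈p∪q⁺ (inj₂ (x∈⁅x⁆ _)) , t∉))
            (x∈p∪q⁺ (inj₁ t∈X))
            λ u∈ → [ walks , (λ u∈⁅⁆ → extend (x∈⁅y⁆⇒x≡y _ u∈⁅⁆)) ]′ (x∈p∪q⁻ X ⁅ tail e ⁆ u∈)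
          where
          extend : ∀ {u} → u ≡ tail e → WalkIn u t
          extend refl = let w , as = walks h∈ in step e refl w , a ∷ as

      path-or-cut : ∀ s t → (Σ[ P ∈ Path D s t ] All A (arcs (proj₁ P))) ⊎
        (∃ λ X → t ∈ X × s ∉ X × (∀ e → A e → head e ∈ X → tail e ∈ X))
      path-or-cut s t
        with grow t ⁅ t ⁆ (⊃-wellFounded _) (x∈⁅x⁆ t)
               (λ u∈ → subst (λ u → WalkIn u t) (sym (x∈⁅y⁆⇒x≡y t u∈)) (done , []))
      ... | X , t∈X , walks , closed with s ∈? X
      ...   | yes s∈X = let w , as = walks s∈X in inj₁ (walk⇒path w as)
      ...   | no s∉X  = inj₂ (X , t∈X , s∉X , closed)

-- Cuts

χ : ∀ {n} → Subset n → Fin n → ℕ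
χ X v = ⟦ Vec.lookup X v ⟧

lookup-∈ : ∀ {n} {X : Subset n} {v} → v ∈ X → Vec.lookup X v ≡ true
lookup-∈ = []=⇒lookup

lookup-∉ : ∀ {n} {X : Subset n} {v} → v ∉ X → Vec.lookup X v ≡ false
lookup-∉ {X = X} {v} v∉ with Vec.lookup X v in eq
... | true  = contradiction (lookup⇒[]= v X eq) v∉
... | false = refl

χ-∈ : ∀ {n} {X : Subset n} {v} → v ∈ X → χ X v ≡ 1
χ-∈ v∈ = cong ⟦_⟧ (lookup-∈ v∈)

χ-∉ : ∀ {n} {X : Subset n} {v} → v ∉ X → χ X v ≡ 0
χ-∉ v∉ = cong ⟦_⟧ (lookup-∉ v∉)

χ-≤1 : ∀ {n} (X : Subset n) v → χ X v ≤ 1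
χ-≤1 X v with Vec.lookup X v
... | true  = ≤-refl
... | false = z≤n

χ-modular : ∀ {n} (X Y : Subset n) v → χ (X ∩ Y) v + χ (X ∪ Y) v ≡ χ X v + χ Y v
χ-modular X Y v
  rewrite lookup-zipWith _∧_ v X Y | lookup-zipWith _∨_ v X Y
  with Vec.lookup X v | Vec.lookup Y v
... | true  | true  = refl
... | true  | false = refl
... | false | true  = refl
... | false | false = refl

module _ {n m : ℕ} where
  open Digraph

  -- For `φ = χ X` this is the sum of the in-degrees over `X`. Counting by arcs lets a reversal be
  -- followed arc by arc.
  headWeight : (Fin n → ℕ) → Digraph n m → ℕ
  headWeight φ D = ∑ (λ e → φ (head D e))

  inCut : Digraph n m → Subset n → ℕ
  inCut D X = ∑ (λ e → ⟦ Vec.lookup X (head D e) ∧ not (Vec.lookup X (tail D e)) ⟧)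

  inDegree-∑ : ∀ D v → inDegree D v ≡ headWeight (λ u → δ u v) D
  inDegree-∑ D v =
    trans (length-filter-sum (λ e → head D e ≟ v) (allFin m)) (sum-map-allFin {m} _)

  ∑-inDegree : ∀ φ D → ∑ (λ v → φ v * inDegree D v) ≡ headWeight φ D
  ∑-inDegree φ D = begin
    ∑ (λ v → φ v * inDegree D v)
      ≡⟨ sum-cong-≗ (λ v → trans (cong (φ v *_) (inDegree-∑ D v)) (*-distribˡ-sum (φ v) (λ e → δ (head D e) v))) ⟩
    ∑ (λ v → ∑ (λ e → φ v * δ (head D e) v))
      ≡⟨ ∑-comm (λ v e → φ v * δ (head D e) v) ⟩
    ∑ (λ e → ∑ (λ v → φ v * δ (head D e) v))
      ≡⟨ sum-cong-≗ (λ e → ∑-pick φ (head D e)) ⟩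
    headWeight φ D ∎
    where open ≡-Reasoning

  headWeight-modular : ∀ D X Y →
    headWeight (χ (X ∩ Y)) D + headWeight (χ (X ∪ Y)) D ≡ headWeight (χ X) D + headWeight (χ Y) D
  headWeight-modular D X Y = begin
    headWeight (χ (X ∩ Y)) D + headWeight (χ (X ∪ Y)) D
      ≡⟨ ∑-distrib-+ (χ (X ∩ Y) ∘ head D) (χ (X ∪ Y) ∘ head D) ⟨
    ∑ (λ e → χ (X ∩ Y) (head D e) + χ (X ∪ Y) (head D e))
      ≡⟨ sum-cong-≗ (λ e → χ-modular X Y (head D e)) ⟩
    ∑ (λ e → χ X (head D e) + χ Y (head D e))
      ≡⟨ ∑-distrib-+ (χ X ∘ head D) (χ Y ∘ head D) ⟩
    headWeight (χ X) D + headWeight (χ Y) D ∎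
    where open ≡-Reasoning

  -- The inequality holds for each arc separately, which leaves a Boolean check on the membership of
  -- its two ends.
  inCut-submodular : ∀ D X Y → inCut D (X ∩ Y) + inCut D (X ∪ Y) ≤ inCut D X + inCut D Y
  inCut-submodular D X Y = begin
    inCut D (X ∩ Y) + inCut D (X ∪ Y)  ≡⟨ ∑-distrib-+ (f (X ∩ Y)) (f (X ∪ Y)) ⟨
    ∑ (λ e → f (X ∩ Y) e + f (X ∪ Y) e) ≤⟨ ∑-mono-≤ pointwise ⟩
    ∑ (λ e → f X e + f Y e)            ≡⟨ ∑-distrib-+ (f X) (f Y) ⟩
    inCut D X + inCut D Y              ∎
    where
    open ≤-Reasoning
    f : Subset n → Fin m → ℕ
    f X e = ⟦ Vec.lookup X (head D e) ∧ not (Vec.lookup X (tail D e)) ⟧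
    bool : ∀ a b c d → ⟦ (a ∧ b) ∧ not (c ∧ d) ⟧ + ⟦ (a ∨ b) ∧ not (c ∨ d) ⟧ ≤
                       ⟦ a ∧ not c ⟧ + ⟦ b ∧ not d ⟧
    bool false false c     d     = z≤n
    bool false true  false false = ≤-refl
    bool false true  false true  = z≤n
    bool false true  true  false = z≤n
    bool false true  true  true  = z≤n
    bool true  false false false = ≤-refl
    bool true  false false true  = z≤n
    bool true  false true  false = z≤n
    bool true  false true  true  = z≤n
    bool true  true  false false = ≤-refl
    bool true  true  false true  = ≤-refl
    bool true  true  true  false = ≤-refl
    bool true  true  true  true  = z≤n
    pointwise : ∀ e → f (X ∩ Y) e + f (X ∪ Y) e ≤ f X e + f Y e
    pointwise e
      rewrite lookup-zipWith _∧_ (head D e) X Y | lookup-zipWith _∨_ (head D e) X Y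
            | lookup-zipWith _∧_ (tail D e) X Y | lookup-zipWith _∨_ (tail D e) X Y =
      bool (Vec.lookup X (head D e)) _ (Vec.lookup X (tail D e)) _

  arc-enters : ∀ D {X e} → tail D e ∉ X → head D e ∈ X → 1 ≤ inCut D X
  arc-enters D {X} {e} t∉ h∈ = begin
    1         ≡⟨ ∑-δ e ⟨
    ∑ (δ e)   ≤⟨ ∑-mono-≤ pointwise ⟩
    inCut D X ∎
    where
    open ≤-Reasoning
    pointwise : ∀ e′ → δ e e′ ≤ ⟦ Vec.lookup X (head D e′) ∧ not (Vec.lookup X (tail D e′)) ⟧
    pointwise e′ with e ≟ e′
    ... | yes refl rewrite lookup-∈ h∈ | lookup-∉ t∉ = ≤-refl
    ... | no _     = z≤n

  closed⇒inCut≡0 : ∀ D {X} → (∀ e → head D e ∈ X → tail D e ∈ X) → inCut D X ≡ 0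
  closed⇒inCut≡0 D {X} closed = trans (sum-cong-≗ pointwise) (sum-replicate-zero m)
    where
    pointwise : ∀ e → ⟦ Vec.lookup X (head D e) ∧ not (Vec.lookup X (tail D e)) ⟧ ≡ 0
    pointwise e with head D e ∈? X
    ... | yes h∈ rewrite lookup-∈ h∈ | lookup-∈ (closed e h∈) = refl
    ... | no h∉  rewrite lookup-∉ h∉ = refl

  inCut-pos⇒arc : ∀ D X → 1 ≤ inCut D X → ∃ λ e → tail D e ∉ X × head D e ∈ X
  inCut-pos⇒arc D X pos with any? (λ e → ¬? (tail D e ∈? X) ×-dec (head D e ∈? X))
  ... | yes found = found
  ... | no none   = contradiction
    (closed⇒inCut≡0 D λ e h∈ → decidable-stable (tail D e ∈? X) λ t∉ → none (e , t∉ , h∈))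
    (m<n⇒n≢0 pos)

  strong-inCut : ∀ {D X u v} → StronglyConnected D → u ∉ X → v ∈ X → 1 ≤ inCut D X
  strong-inCut {D} {u = u} {v} strong u∉ v∈ =
    let e , t∉ , h∈ = walk-enters (proj₁ (strong u v)) u∉ v∈ in arc-enters D t∉ h∈

  -- Reorientations of a common graph

  Reorients : Digraph n m → Digraph n m → Set
  Reorients D D′ = ∀ e → (tail D′ e ≡ tail D e × head D′ e ≡ head D e) ⊎
                         (tail D′ e ≡ head D e × head D′ e ≡ tail D e)

  -- The edges spanned by X count equally for D and D′; moving terms avoids subtraction.
  inCut-headWeight : ∀ {D D′} → Reorients D D′ → ∀ X →
    inCut D X + headWeight (χ X) D′ ≡ inCut D′ X + headWeight (χ X) D
  inCut-headWeight {D} {D′} re X =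
    trans (sym (∑-distrib-+ (f D) _)) (trans (sum-cong-≗ pointwise) (∑-distrib-+ (f D′) _))
    where
    f : Digraph n m → Fin m → ℕ
    f D e = ⟦ Vec.lookup X (head D e) ∧ not (Vec.lookup X (tail D e)) ⟧
    bool : ∀ a b → ⟦ a ∧ not b ⟧ + ⟦ b ⟧ ≡ ⟦ b ∧ not a ⟧ + ⟦ a ⟧
    bool false false = refl
    bool false true  = refl
    bool true  false = refl
    bool true  true  = refl
    pointwise : ∀ e → f D e + χ X (head D′ e) ≡ f D′ e + χ X (head D e)
    pointwise e with re e
    ... | inj₁ (p , q) rewrite p | q = refl
    ... | inj₂ (p , q) rewrite p | q = bool (Vec.lookup X (head D e)) (Vec.lookup X (tail D e))

  orientations-Reorient : ∀ {G D D′} → IsOrientation G D → IsOrientation G D′ → Reorients D D′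
  orientations-Reorient oD oD′ e with oD e | oD′ e
  ... | inj₁ p | inj₁ q = inj₁ (cong proj₁ (trans q (sym p)) , cong proj₂ (trans q (sym p)))
  ... | inj₂ p | inj₂ q = inj₁ (cong proj₁ (trans q (sym p)) , cong proj₂ (trans q (sym p)))
  ... | inj₁ p | inj₂ q = inj₂ (trans (cong proj₁ q) (sym (cong proj₂ p)) ,
                               trans (cong proj₂ q) (sym (cong proj₁ p)))
  ... | inj₂ p | inj₁ q = inj₂ (trans (cong proj₁ q) (sym (cong proj₂ p)) ,
                               trans (cong proj₂ q) (sym (cong proj₁ p)))

  Reorients-orientation : ∀ {G D D′} → IsOrientation G D → Reorients D D′ → IsOrientation G D′
  Reorients-orientation oD re e with oD e | re e
  ... | inj₁ p | inj₁ (q , r) = inj₁ (trans (cong₂ _,_ q r) p)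
  ... | inj₂ p | inj₁ (q , r) = inj₂ (trans (cong₂ _,_ q r) p)
  ... | inj₁ p | inj₂ (q , r) = inj₂ (trans (cong₂ _,_ q r) (cong swap p))
  ... | inj₂ p | inj₂ (q , r) = inj₁ (trans (cong₂ _,_ q r) (cong swap p))

  Reorients-trans : ∀ {D D′ D″} → Reorients D D′ → Reorients D′ D″ → Reorients D D″
  Reorients-trans r r′ e with r e | r′ e
  ... | inj₁ (p , q) | inj₁ (p′ , q′) = inj₁ (trans p′ p , trans q′ q)
  ... | inj₁ (p , q) | inj₂ (p′ , q′) = inj₂ (trans p′ q , trans q′ p)
  ... | inj₂ (p , q) | inj₁ (p′ , q′) = inj₂ (trans p′ p , trans q′ q)
  ... | inj₂ (p , q) | inj₂ (p′ , q′) = inj₁ (trans p′ q , trans q′ p)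

  Reorients-sym : ∀ {D D′} → Reorients D D′ → Reorients D′ D
  Reorients-sym r e with r e
  ... | inj₁ (p , q) = inj₁ (sym p , sym q)
  ... | inj₂ (p , q) = inj₂ (sym q , sym p)

-- Reversing the arcs of a path

module _ {n m : ℕ} where
  open Digraph
  open DecMembership (_≟_ {m}) using () renaming (_∈?_ to _∈ₗ?_)

  reverseArcs : Digraph n m → List (Fin m) → Digraph n m
  reverseArcs D es = record
    { tail = λ e → if does (e ∈ₗ? es) then head D e else tail D e
    ; head = λ e → if does (e ∈ₗ? es) then tail D e else head D e
    }

  module _ {D : Digraph n m} where

    tail-reversed : ∀ {e es} → e ∈ₗ es → tail (reverseArcs D es) e ≡ head D e
    tail-reversed {e} {es} e∈ rewrite dec-true (e ∈ₗ? es) e∈ = refl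

    head-reversed : ∀ {e es} → e ∈ₗ es → head (reverseArcs D es) e ≡ tail D e
    head-reversed {e} {es} e∈ rewrite dec-true (e ∈ₗ? es) e∈ = refl

    tail-kept : ∀ {e es} → e ∉ₗ es → tail (reverseArcs D es) e ≡ tail D e
    tail-kept {e} {es} e∉ rewrite dec-false (e ∈ₗ? es) e∉ = refl

    head-kept : ∀ {e es} → e ∉ₗ es → head (reverseArcs D es) e ≡ head D e
    head-kept {e} {es} e∉ rewrite dec-false (e ∈ₗ? es) e∉ = refl

    reverseArcs-Reorients : ∀ es → Reorients D (reverseArcs D es)
    reverseArcs-Reorients es e with e ∈ₗ? es
    ... | yes _ = inj₂ (refl , refl)
    ... | no _  = inj₁ (refl , refl)

    headWeight-reverse-∷ : ∀ φ {e es} → e ∉ₗ es →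
      headWeight φ (reverseArcs D (e ∷ es)) + φ (head D e) ≡
      headWeight φ (reverseArcs D es) + φ (tail D e)
    headWeight-reverse-∷ φ {e} {es} e∉ =
      subst₂ (λ a b → ∑ f + φ a ≡ ∑ g + φ b) (head-kept e∉) (head-reversed {es = e ∷ es} (here refl))
        (∑-exchange f g e same)
      where
      f = λ e′ → φ (head (reverseArcs D (e ∷ es)) e′)
      g = λ e′ → φ (head (reverseArcs D es) e′)
      same : ∀ e′ → e′ ≢ e → f e′ ≡ g e′
      same e′ e′≢e = cong φ (case e′ ∈ₗ? es of λ
        { (yes e′∈) → trans (head-reversed {es = e ∷ es} (there e′∈)) (sym (head-reversed e′∈))
        ; (no e′∉)  → trans (head-kept {es = e ∷ es} λ { (here eq) → e′≢e eq ; (there e′∈) → e′∉ e′∈ })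
                            (sym (head-kept e′∉))
        })

    -- Reversing an arc trades `φ` of its head for `φ` of its tail, so the changes telescope along
    -- the walk and only the two ends remain.
    headWeight-reverse : ∀ φ {u v} (w : Walk D u v) → Unique (arcs w) →
      headWeight φ (reverseArcs D (arcs w)) + φ v ≡ headWeight φ D + φ u
    headWeight-reverse φ done uniq = refl
    headWeight-reverse φ {v = v} (step e refl w) (e∉ ∷ uniq) =
      +-cancelʳ-≡ (φ (head D e)) _ _ (begin
        W′ + φ v + φ (head D e)              ≡⟨ lemma W′ (φ v) (φ (head D e)) ⟩
        W′ + φ (head D e) + φ v
          ≡⟨ cong (_+ φ v) (headWeight-reverse-∷ φ λ e∈ → All.lookup e∉ e∈ refl) ⟩
        W″ + φ (tail D e) + φ v              ≡⟨ lemma W″ (φ (tail D e)) (φ v) ⟩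
        W″ + φ v + φ (tail D e)              ≡⟨ cong (_+ φ (tail D e)) (headWeight-reverse φ w uniq) ⟩
        headWeight φ D + φ (head D e) + φ (tail D e) ≡⟨ lemma (headWeight φ D) (φ (head D e)) (φ (tail D e)) ⟩
        headWeight φ D + φ (tail D e) + φ (head D e) ∎)
      where
      open ≡-Reasoning
      W′ = headWeight φ (reverseArcs D (e ∷ arcs w))
      W″ = headWeight φ (reverseArcs D (arcs w))
      lemma : ∀ a b c → a + b + c ≡ a + c + b
      lemma = solve-∀

    reversed-walks : ∀ {es u v e} (w : Walk D u v) → All (_∈ₗ es) (arcs w) → e ∈ₗ arcs w →
      Walk (reverseArcs D es) v (head D e) × Walk (reverseArcs D es) (tail D e) u
    reversed-walk : ∀ {es u v} (w : Walk D u v) → All (_∈ₗ es) (arcs w) →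
      Walk (reverseArcs D es) v u
    reversed-walk done as = done
    reversed-walk (step e refl w) (a ∷ as) =
      reversed-walk w as ++ʷ step e (tail-reversed a) (subst (λ v → Walk _ v _) (sym (head-reversed a)) done)
    reversed-walks (step e refl w) (a ∷ as) (here refl) = reversed-walk w as , done
    reversed-walks (step e refl w) (a ∷ as) (there e∈) with reversed-walks w as e∈
    ... | p , q = p , q ++ʷ step e (tail-reversed a) (subst (λ v → Walk _ v _) (sym (head-reversed a)) done)

    kept-walk : ∀ {es u v} (w : Walk D u v) → All (_∉ₗ es) (arcs w) → Walk (reverseArcs D es) u v
    kept-walk done as = done
    kept-walk (step e refl w) (a ∷ as) =
      step e (tail-kept a) (subst (λ v → Walk _ v _) (sym (head-kept a)) (kept-walk w as))

    unreverse-walk : ∀ {es u v} (w : Walk (reverseArcs D es) u v) → All (_∉ₗ es) (arcs w) →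
      Σ[ w′ ∈ Walk D u v ] All (_∉ₗ es) (arcs w′)
    unreverse-walk done as = done , []
    unreverse-walk (step e eq w) (a ∷ as) with unreverse-walk w as
    ... | w′ , as′ rewrite head-kept {e = e} a = step e (trans (sym (tail-kept a)) eq) w′ , a ∷ as′

    -- A lost arc of the first path is replaced by a detour: along reversed arcs from its tail to
    -- `s`, along the untouched second path to `t`, and along reversed arcs to its head.
    reverse-strong : StronglyConnected D → ∀ {s t} (P Q : Path D s t) → ArcDisjoint P Q →
      StronglyConnected (reverseArcs D (arcs (proj₁ P)))
    reverse-strong strong (p , _) (q , _) disjoint u v =
      proj₁ (walk⇒path (translate (proj₁ (strong u v))) (All.universal (λ _ → tt) _))
      where
      es = arcs p
      detour : ∀ e → Walk (reverseArcs D es) (tail D e) (head D e)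
      detour e = case e ∈ₗ? es of λ
        { (yes e∈) → let t⇝ , ⇝s = reversed-walks p (All.tabulate id) e∈ in
            ⇝s ++ʷ (kept-walk q (All.tabulate λ e∈q e∈p → disjoint (e∈p , e∈q)) ++ʷ t⇝)
        ; (no e∉) → kept-walk (arc e) (e∉ ∷ [])
        }
      translate : ∀ {u v} → Walk D u v → Walk (reverseArcs D es) u v
      translate done            = done
      translate (step e refl w) = detour e ++ʷ translate w

-- Menger's theorem for two paths

module _ {n m : ℕ} where
  open Digraph

  Cut : Digraph n m → Fin n → Fin n → Set
  Cut D s t = ∃ λ X → inCut D X ≤ 1 × t ∈ X × s ∉ X

  cut? : ∀ D s t → Dec (Cut D s t)
  cut? D s t = anySubset? λ X → (inCut D X ≤? 1) ×-dec (t ∈? X) ×-dec ¬? (s ∈? X)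

  path-or-inCut≡0 : ∀ (D : Digraph n m) s t → Path D s t ⊎ (∃ λ X → t ∈ X × s ∉ X × inCut D X ≡ 0)
  path-or-inCut≡0 D s t with path-or-cut {D = D} {A = λ _ → Unit} (λ _ → yes tt) s t
  ... | inj₁ (P , _) = inj₁ P
  ... | inj₂ (X , t∈X , s∉X , closed) = inj₂ (X , t∈X , s∉X , closed⇒inCut≡0 D λ e → closed e tt)

  -- Without such a path there is a set `X` that no differing arc enters. Every arc with head in `X`
  -- then keeps its head in `X` under `D′`, so the weight of `X` cannot drop.
  path-along-difference : ∀ {D D′ : Digraph n m} {s t} → Reorients D D′ →
    (∀ X → t ∈ X → s ∉ X → headWeight (χ X) D′ < headWeight (χ X) D) →
    Σ[ P ∈ Path D s t ] All (λ e → head D′ e ≢ head D e) (arcs (proj₁ P))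
  path-along-difference {D} {D′} {s} {t} re less
    with path-or-cut {D = D} (λ e → ¬? (head D′ e ≟ head D e)) s t
  ... | inj₁ path = path
  ... | inj₂ (X , t∈X , s∉X , closed) =
    contradiction (less X t∈X s∉X) (≤⇒≯ (∑-mono-≤ pointwise))
    where
    stays : ∀ e → head D e ∈ X → head D′ e ∈ X
    stays e h∈ with head D′ e ≟ head D e | re e
    ... | yes eq | _            = subst (_∈ X) (sym eq) h∈
    ... | no ne  | inj₁ (_ , q) = contradiction q ne
    ... | no ne  | inj₂ (_ , q) = subst (_∈ X) (sym q) (closed e ne h∈)
    pointwise : ∀ e → χ X (head D e) ≤ χ X (head D′ e)
    pointwise e with head D e ∈? X
    ... | yes h∈ = ≤-trans (χ-≤1 X _) (≤-reflexive (sym (χ-∈ (stays e h∈))))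
    ... | no h∉  = ≤-trans (≤-reflexive (χ-∉ h∉)) z≤n

  headWeight-reverse-χ : ∀ {D : Digraph n m} {s t} (P : Path D s t) {X} → t ∈ X → s ∉ X →
    suc (headWeight (χ X) (reverseArcs D (arcs (proj₁ P)))) ≡ headWeight (χ X) D
  headWeight-reverse-χ {D} {s} {t} (p , uniq) {X} t∈X s∉X = begin
    suc W                 ≡⟨ +-comm 1 W ⟩
    W + 1                 ≡⟨ cong (W +_) (χ-∈ t∈X) ⟨
    W + χ X t             ≡⟨ headWeight-reverse (χ X) p (unique-arcs p uniq) ⟩
    headWeight (χ X) D + χ X s ≡⟨ cong (headWeight (χ X) D +_) (χ-∉ s∉X) ⟩
    headWeight (χ X) D + 0 ≡⟨ +-identityʳ _ ⟩
    headWeight (χ X) D    ∎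
    where
    open ≡-Reasoning
    W = headWeight (χ X) (reverseArcs D (arcs p))

  -- Reversing P and then a path Q of the result moves two units of in-degree from t to s;
  -- the arcs on which D and the outcome differ carry the two disjoint paths.
  menger₂ : ∀ {D : Digraph n m} {s t} → ¬ Cut D s t → ∃₂ λ (P Q : Path D s t) → ArcDisjoint P Q
  menger₂ {D} {s} {t} ¬cut = first (path-or-inCut≡0 D s t)
    where
    Result = ∃₂ λ (P Q : Path D s t) → ArcDisjoint P Q

    module _ (P : Path D s t) where
      D₁ = reverseArcs D (arcs (proj₁ P))
      D→D₁ = reverseArcs-Reorients {D = D} (arcs (proj₁ P))

      module _ (Q : Path D₁ s t) where
        D₂ = reverseArcs D₁ (arcs (proj₁ Q))
        D→D₂ = Reorients-trans {D = D} {D₁} {D₂} D→D₁ (reverseArcs-Reorients {D = D₁} (arcs (proj₁ Q)))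

        drop₂ : ∀ X → t ∈ X → s ∉ X → suc (suc (headWeight (χ X) D₂)) ≡ headWeight (χ X) D
        drop₂ X t∈X s∉X = trans (cong suc (headWeight-reverse-χ Q t∈X s∉X)) (headWeight-reverse-χ P t∈X s∉X)

        module _ (P₁ : Path D s t) (differ₁ : All (λ e → head D₂ e ≢ head D e) (arcs (proj₁ P₁))) where
          es = arcs (proj₁ P₁)
          D₃ = reverseArcs D es

          D₃→D₂ : Reorients D₃ D₂
          D₃→D₂ = Reorients-trans {D = D₃} {D} {D₂}
            (Reorients-sym {D = D} {D₃} (reverseArcs-Reorients {D = D} es)) D→D₂

          -- `D₂` and `D₃` both reverse the arcs of `P₁`. A path along which these two differ
          -- therefore avoids `P₁`, and so gives a walk of `D`.
          agree : ∀ {e} → e ∈ₗ es → head D₂ e ≡ head D₃ e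
          agree {e} e∈ with D→D₂ e
          ... | inj₁ (_ , q) = contradiction q (All.lookup differ₁ e∈)
          ... | inj₂ (_ , q) = trans q (sym (head-reversed {D = D} e∈))

          fourth : (Σ[ P₂ ∈ Path D₃ s t ] All (λ e → head D₂ e ≢ head D₃ e) (arcs (proj₁ P₂))) → Result
          fourth ((p₂ , _) , differ₂) =
            let w , avoid   = unreverse-walk {D = D} p₂ (All.map (λ ne e∈ → ne (agree e∈)) differ₂)
                P₂ , avoid₂ = walk⇒path w avoid
            in P₁ , P₂ , λ (e∈₁ , e∈₂) → All.lookup avoid₂ e∈₂ e∈₁

          third : Result
          -- On every set containing `t` but not `s`, `D₃` has lost one unit and `D₂` two, so the
          -- weight still drops from `D₃` to `D₂`.
          third = fourth (path-along-difference {D = D₃} {D₂} D₃→D₂ λ X t∈X s∉X →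
            ≤-reflexive (suc-injective (trans (drop₂ X t∈X s∉X) (sym (headWeight-reverse-χ P₁ t∈X s∉X)))))

      second : Path D₁ s t ⊎ (∃ λ X → t ∈ X × s ∉ X × inCut D₁ X ≡ 0) → Result
      second (inj₁ Q) =
        let P₁ , differ₁ = path-along-difference {D = D} {D₂ Q} (D→D₂ Q) λ X t∈X s∉X →
              ≤-trans (n≤1+n _) (≤-reflexive (drop₂ Q X t∈X s∉X))
        in third Q P₁ differ₁
      -- Reversing `P` lowers the in-degree of `X` by one, so in-degree 0 afterwards means in-degree
      -- 1 in `D`, a forbidden cut.
      second (inj₂ (X , t∈X , s∉X , cut≡0)) = contradiction (X , ≤-reflexive cut≡1 , t∈X , s∉X) ¬cut
        where
        open ≡-Reasoning
        W₁ = headWeight (χ X) D₁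
        cut≡1 : inCut D X ≡ 1
        cut≡1 = +-cancelʳ-≡ W₁ _ _ (begin
          inCut D X + W₁                   ≡⟨ inCut-headWeight {D = D} {D₁} D→D₁ X ⟩
          inCut D₁ X + headWeight (χ X) D  ≡⟨ cong (_+ headWeight (χ X) D) cut≡0 ⟩
          headWeight (χ X) D               ≡⟨ headWeight-reverse-χ P t∈X s∉X ⟨
          1 + W₁                           ∎)

    first : Path D s t ⊎ (∃ λ X → t ∈ X × s ∉ X × inCut D X ≡ 0) → Result
    first (inj₁ P) = second P (path-or-inCut≡0 (D₁ P) s t)
    first (inj₂ (X , t∈X , s∉X , cut≡0)) = contradiction
      (X , ≤-trans (≤-reflexive cut≡0) z≤n , t∈X , s∉X) ¬cut

-- Sets separated by tight cuts

module _ {n m : ℕ} where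
  open Digraph

  headWeight-full : ∀ (D D′ : Digraph n m) {X} → (∀ v → v ∈ X) →
    headWeight (χ X) D ≡ headWeight (χ X) D′
  headWeight-full D D′ full = sum-cong-≗ λ e → trans (χ-∈ (full (head D e))) (sym (χ-∈ (full (head D′ e))))

  headWeight-empty : ∀ (D D′ : Digraph n m) {X} → ¬ Nonempty X →
    headWeight (χ X) D ≡ headWeight (χ X) D′
  headWeight-empty D D′ empty =
    sum-cong-≗ λ e → trans (χ-∉ (empty ∘ (head D e ,_))) (sym (χ-∉ (empty ∘ (head D′ e ,_))))

  -- From `D` to `D′` the in-degree of `X` and its in-degree sum change by the same amount. If `D`
  -- has an arc entering `X`, its ends show that `D′` must have one too; otherwise the in-degree is
  -- already 0.
  tight-headWeight-≤ : ∀ {D D′ : Digraph n m} → StronglyConnected D′ → Reorients D D′ →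
    ∀ {X} → inCut D X ≤ 1 → headWeight (χ X) D ≤ headWeight (χ X) D′
  tight-headWeight-≤ {D} {D′} strong′ re {X} tight = +-cancelˡ-≤ (inCut D X) _ _ (begin
    inCut D X + headWeight (χ X) D   ≤⟨ +-monoˡ-≤ _ cut≤ ⟩
    inCut D′ X + headWeight (χ X) D  ≡⟨ inCut-headWeight {D = D} {D′} re X ⟨
    inCut D X + headWeight (χ X) D′  ∎)
    where
    open ≤-Reasoning
    cut≤ : inCut D X ≤ inCut D′ X
    cut≤ with 1 ≤? inCut D X
    ... | yes pos = let e , t∉ , h∈ = inCut-pos⇒arc D X pos in
                    ≤-trans tight (strong-inCut strong′ t∉ h∈)
    ... | no ¬pos = ≤-trans (≤-pred (≰⇒> ¬pos)) z≤n

  separated-headWeight-≤ : ∀ {D D′ : Digraph n m} → StronglyConnected D → StronglyConnected D′ →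
    Reorients D D′ → ∀ {U} → (∀ {s t} → t ∈ U → s ∉ U → Cut D s t) →
    headWeight (χ U) D ≤ headWeight (χ U) D′
  separated-headWeight-≤ {D} {D′} strong strong′ re separate =
    Join⊆P (λ X → headWeight (χ X) D ≤ headWeight (χ X) D′)
      (λ {X} → tight-headWeight-≤ {D = D} strong′ re {X})
      (≤-reflexive (headWeight-full D D′ λ _ → ∈⊤))
      (≤-reflexive (headWeight-empty D D′ λ (_ , v∈) → ∉⊥ v∈))
      -- A union that is everything, or in the next case an empty intersection, weighs the same in
      -- `D` and `D′` and cancels from the sum of both inequalities.
      (λ {X} {Y} pX pY c → +-cancelʳ-≤ (headWeight (χ (X ∪ Y)) D) _ _
        (modular-≤ X Y pX pY refl (sym (headWeight-full D D′ c))))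
      (λ {X} {Y} pX pY dis → +-cancelˡ-≤ (headWeight (χ (X ∩ Y)) D) _ _
        (modular-≤ X Y pX pY (sym (headWeight-empty D D′ dis)) refl))
      (separated⇒Join separate)
    where
    -- Strong connectivity gives the intersection and the union in-degree at least 1 each, while
    -- submodularity bounds the total by 2.
    crossing : ∀ {X Y} → inCut D X ≤ 1 → inCut D Y ≤ 1 →
      Nonempty (X ∩ Y) → (∃ λ v → v ∉ X ∪ Y) → inCut D (X ∩ Y) ≤ 1 × inCut D (X ∪ Y) ≤ 1
    crossing {X} {Y} tX tY (u , u∈) (v , v∉) =
      +-cancelʳ-≤ 1 _ _ (≤-trans (+-monoʳ-≤ _ (strong-inCut strong v∉ (x∈p∪q⁺ (inj₁ (p∩q⊆p X Y u∈))))) total) ,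
      +-cancelˡ-≤ 1 _ _ (≤-trans (+-monoˡ-≤ _ (strong-inCut strong (v∉ ∘ x∈p∪q⁺ ∘ inj₁ ∘ p∩q⊆p X Y) u∈)) total)
      where
      total : inCut D (X ∩ Y) + inCut D (X ∪ Y) ≤ 2
      total = ≤-trans (inCut-submodular D X Y) (+-mono-≤ tX tY)

    open Uncross (λ X → inCut D X ≤ 1)
      (λ tX tY ne v∉ → proj₁ (crossing tX tY ne v∉)) (λ tX tY ne v∉ → proj₂ (crossing tX tY ne v∉))

    modular-≤ : ∀ X Y → headWeight (χ X) D ≤ headWeight (χ X) D′ →
      headWeight (χ Y) D ≤ headWeight (χ Y) D′ → ∀ {a b} →
      headWeight (χ (X ∩ Y)) D′ ≡ a → headWeight (χ (X ∪ Y)) D′ ≡ b →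
      headWeight (χ (X ∩ Y)) D + headWeight (χ (X ∪ Y)) D ≤ a + b
    modular-≤ X Y pX pY refl refl =
      subst₂ _≤_ (sym (headWeight-modular D X Y)) (sym (headWeight-modular D′ X Y)) (+-mono-≤ pX pY)

-- The criterion

subset : ∀ {n ℓ} {P : Pred (Fin n) ℓ} → Decidable P → Subset n
subset P? = Vec.tabulate (does ∘ P?)

module _ {n ℓ} {P : Pred (Fin n) ℓ} (P? : Decidable P) where

  ∈-subset⁺ : ∀ {v} → P v → v ∈ subset P?
  ∈-subset⁺ {v} p = lookup⇒[]= v _ (trans (lookup∘tabulate _ v) (dec-true (P? v) p))

  ∈-subset⁻ : ∀ {v} → v ∈ subset P? → P v
  ∈-subset⁻ {v} v∈ with P? v | trans (sym (lookup∘tabulate (does ∘ P?) v)) ([]=⇒lookup v∈)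
  ... | yes p | _ = p
  ... | no _  | ()

module _ {n m : ℕ} where

  ImprovingPair : Digraph n m → Set
  ImprovingPair D =
    ∃₂ λ s t → inDegree D t ≥ inDegree D s + 2 × ∃₂ λ (P Q : Path D s t) → ArcDisjoint P Q

  hinge-inDegreeVector : ∀ j (D : Digraph n m) →
    hinge j (inDegreeVector D) ≡ ∑ (λ v → inDegree D v ∸ j)
  hinge-inDegreeVector j D =
    trans (cong sum (sym (map-∘ (allFin n)))) (sum-map-allFin (λ v → inDegree D v ∸ j))

  length-inDegreeVector : ∀ (D D′ : Digraph n m) →
    length (inDegreeVector D) ≡ length (inDegreeVector D′)
  length-inDegreeVector D D′ =
    trans (length-map (inDegree D) (allFin n)) (sym (length-map (inDegree D′) (allFin n)))

  module _ {D D′ : Digraph n m} (strong : StronglyConnected D) (strong′ : StronglyConnected D′)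
    (re : Reorients D D′) (¬improving : ¬ ImprovingPair D) (j : ℕ) where

    private
      x  = inDegree D
      x′ = inDegree D′

      Upper : Pred (Fin n) _
      Upper s = ∃ λ t → j < x t × ¬ Cut D s t

      upper? : Decidable Upper
      upper? s = any? λ t → (j <? x t) ×-dec ¬? (cut? D s t)

      U = subset upper?

      -- A set `X` separating `s` from the `r` that puts `t` into `U` also contains `t`, as it would
      -- otherwise separate `t` from `r`.
      upper-separated : ∀ {s t} → t ∈ U → s ∉ U → Cut D s t
      upper-separated {s} {t} t∈U s∉U with ∈-subset⁻ upper? t∈U
      ... | r , j<xr , ¬cut-tr
        with decidable-stable (cut? D s r) (λ ¬cut-sr → s∉U (∈-subset⁺ upper? (r , j<xr , ¬cut-sr)))
      ...   | X , tight , r∈X , s∉X =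
        X , tight , decidable-stable (t ∈? X) (λ t∉X → ¬cut-tr (X , tight , r∈X , t∉X)) , s∉X

      -- If `x s < j < x t`, the two strict inequalities give a gap of two, and the missing cut
      -- gives two disjoint paths: an improving pair.
      upper-≥ : ∀ {s} → s ∈ U → j ≤ x s
      upper-≥ {s} s∈U with ∈-subset⁻ upper? s∈U
      ... | t , j<xt , ¬cut = ≮⇒≥ λ xs<j →
        ¬improving (s , t , ≤-trans (≤-reflexive (+-comm (x s) 2)) (≤-trans (s≤s xs<j) j<xt) , menger₂ ¬cut)

      above-∈ : ∀ {v} → j < x v → v ∈ U
      -- The witness is `v` itself, since no set separates a node from itself.
      above-∈ {v} j<xv = ∈-subset⁺ upper? (v , j<xv , λ (_ , _ , v∈X , v∉X) → v∉X v∈X)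

      ∣U∣*j = ∑ (λ v → χ U v * j)

      -- For `D` truncation is inactive on `U` and annihilates all terms off `U`, hence equality;
      -- for `D′` only an inequality survives.
      hinge-on-U : ∑ (λ v → x v ∸ j) + ∣U∣*j ≡ headWeight (χ U) D
      hinge-on-U = trans (sym (∑-distrib-+ (λ v → x v ∸ j) (λ v → χ U v * j)))
        (trans (sum-cong-≗ pointwise) (∑-inDegree (χ U) D))
        where
        pointwise : ∀ v → (x v ∸ j) + χ U v * j ≡ χ U v * x v
        pointwise v with v ∈? U
        ... | yes v∈ rewrite χ-∈ v∈ | +-identityʳ j | +-identityʳ (x v) = m∸n+n≡m (upper-≥ v∈)
        ... | no v∉  rewrite χ-∉ v∉ | +-identityʳ (x v ∸ j) = m≤n⇒m∸n≡0 (≮⇒≥ (v∉ ∘ above-∈))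

      hinge-off-U : headWeight (χ U) D′ ≤ ∑ (λ v → x′ v ∸ j) + ∣U∣*j
      hinge-off-U = begin
        headWeight (χ U) D′                 ≡⟨ ∑-inDegree (χ U) D′ ⟨
        ∑ (λ v → χ U v * x′ v)              ≤⟨ ∑-mono-≤ pointwise ⟩
        ∑ (λ v → (x′ v ∸ j) + χ U v * j)    ≡⟨ ∑-distrib-+ (λ v → x′ v ∸ j) (λ v → χ U v * j) ⟩
        ∑ (λ v → x′ v ∸ j) + ∣U∣*j              ∎
        where
        open ≤-Reasoning
        pointwise : ∀ v → χ U v * x′ v ≤ (x′ v ∸ j) + χ U v * j
        pointwise v with v ∈? U
        ... | yes v∈ rewrite χ-∈ v∈ | +-identityʳ j | +-identityʳ (x′ v) =
              ≤-trans (m≤n+m∸n (x′ v) j) (≤-reflexive (+-comm j _))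
        ... | no v∉  rewrite χ-∉ v∉ = z≤n

    hinge-≤ : hinge j (inDegreeVector D) ≤ hinge j (inDegreeVector D′)
    hinge-≤ = subst₂ _≤_ (sym (hinge-inDegreeVector j D)) (sym (hinge-inDegreeVector j D′))
      (+-cancelʳ-≤ ∣U∣*j _ _ (≤-trans (≤-reflexive hinge-on-U)
        (≤-trans (separated-headWeight-≤ strong strong′ re upper-separated) hinge-off-U)))

-- Moving one unit from t to s

-- A Robin Hood transfer, the basic step of majorization, written without subtraction.
module _ {n : ℕ} (x x′ : Fin n → ℕ) {s t : Fin n} (gap : x s + 2 ≤ x t)
  (shift : ∀ v → x′ v + δ t v ≡ x v + δ s v) where

  private
    s≢t : s ≢ t
    s≢t refl = <⇒≱ (m<m+n (x s) (s≤s z≤n)) gap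

    at-s : x′ s ≡ suc (x s)
    at-s = begin
      x′ s            ≡⟨ +-identityʳ _ ⟨
      x′ s + 0        ≡⟨ cong (x′ s +_) (δ-≢ (s≢t ∘ sym)) ⟨
      x′ s + δ t s    ≡⟨ shift s ⟩
      x s + δ s s     ≡⟨ cong (x s +_) (δ-≡ s) ⟩
      x s + 1         ≡⟨ +-comm _ 1 ⟩
      suc (x s)       ∎
      where open ≡-Reasoning

    at-t : suc (x′ t) ≡ x t
    at-t = begin
      suc (x′ t)      ≡⟨ +-comm 1 _ ⟩
      x′ t + 1        ≡⟨ cong (x′ t +_) (δ-≡ t) ⟨
      x′ t + δ t t    ≡⟨ shift t ⟩
      x t + δ s t     ≡⟨ cong (x t +_) (δ-≢ s≢t) ⟩
      x t + 0         ≡⟨ +-identityʳ _ ⟩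
      x t             ∎
      where open ≡-Reasoning

    elsewhere : ∀ {v} → s ≢ v → t ≢ v → x′ v ≡ x v
    elsewhere {v} s≢v t≢v = begin
      x′ v            ≡⟨ +-identityʳ _ ⟨
      x′ v + 0        ≡⟨ cong (x′ v +_) (δ-≢ t≢v) ⟨
      x′ v + δ t v    ≡⟨ shift v ⟩
      x v + δ s v     ≡⟨ cong (x v +_) (δ-≢ s≢v) ⟩
      x v + 0         ≡⟨ +-identityʳ _ ⟩
      x v             ∎
      where open ≡-Reasoning

    1+xs<xt : suc (x s) < x t
    1+xs<xt = ≤-trans (≤-reflexive (+-comm 2 (x s))) gap

  -- At levels up to `x s` the gain at `s` and the loss at `t` both count and balance; at higher
  -- levels the gain is truncated away.
  shift-∑-≤ : ∀ j → ∑ (λ v → x′ v ∸ j) ≤ ∑ (λ v → x v ∸ j)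
  shift-∑-≤ j with j ≤? x s
  ... | no j≰xs = ∑-mono-≤ pointwise
    where
    pointwise : ∀ v → x′ v ∸ j ≤ x v ∸ j
    pointwise v with s ≟ v | t ≟ v
    ... | yes refl | _        = ≤-trans (≤-reflexive (m≤n⇒m∸n≡0 (≤-trans (≤-reflexive at-s) (≰⇒> j≰xs)))) z≤n
    ... | no _     | yes refl = ∸-monoˡ-≤ j (≤-trans (n≤1+n _) (≤-reflexive at-t))
    ... | no s≢v   | no t≢v   = ∸-monoˡ-≤ j (≤-reflexive (elsewhere s≢v t≢v))
  ... | yes j≤xs = +-cancelʳ-≤ 1 _ _ (≤-reflexive (begin
      ∑ (λ v → x′ v ∸ j) + 1          ≡⟨ cong (∑ (λ v → x′ v ∸ j) +_) (∑-δ t) ⟨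
      ∑ (λ v → x′ v ∸ j) + ∑ (δ t)    ≡⟨ ∑-distrib-+ (λ v → x′ v ∸ j) (δ t) ⟨
      ∑ (λ v → (x′ v ∸ j) + δ t v)    ≡⟨ sum-cong-≗ pointwise ⟩
      ∑ (λ v → (x v ∸ j) + δ s v)     ≡⟨ ∑-distrib-+ (λ v → x v ∸ j) (δ s) ⟩
      ∑ (λ v → x v ∸ j) + ∑ (δ s)     ≡⟨ cong (∑ (λ v → x v ∸ j) +_) (∑-δ s) ⟩
      ∑ (λ v → x v ∸ j) + 1           ∎))
    where
    open ≡-Reasoning
    pointwise : ∀ v → (x′ v ∸ j) + δ t v ≡ (x v ∸ j) + δ s v
    pointwise v with s ≟ v | t ≟ v
    ... | yes refl | yes refl = contradiction refl s≢t
    ... | yes refl | no _     rewrite at-s = trans (+-identityʳ _) (trans (+-∸-assoc 1 j≤xs) (+-comm 1 _))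
    ... | no _     | yes refl = trans (+-comm _ 1)
        (trans (sym (+-∸-assoc 1 j≤x′t)) (trans (cong (_∸ j) at-t) (sym (+-identityʳ _))))
      where
      j≤x′t : j ≤ x′ t
      j≤x′t = ≤-pred (≤-trans (≤-trans (s≤s (≤-trans j≤xs (n≤1+n _))) 1+xs<xt) (≤-reflexive (sym at-t)))
    ... | no s≢v   | no t≢v   = cong (λ a → (a ∸ j) + 0) (elsewhere s≢v t≢v)

  -- The level `x′ t` is one below `x t`, so `t` contributes 1 before and 0 after, while the gap
  -- keeps `x′ s` at or below this level.
  shift-∑-< : ∑ (λ v → x′ v ∸ x′ t) < ∑ (λ v → x v ∸ x′ t)
  shift-∑-< = begin
    suc (∑ (λ v → x′ v ∸ j))        ≡⟨ +-comm 1 _ ⟩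
    ∑ (λ v → x′ v ∸ j) + 1          ≡⟨ cong (∑ (λ v → x′ v ∸ j) +_) (∑-δ t) ⟨
    ∑ (λ v → x′ v ∸ j) + ∑ (δ t)    ≡⟨ ∑-distrib-+ (λ v → x′ v ∸ j) (δ t) ⟨
    ∑ (λ v → (x′ v ∸ j) + δ t v)    ≤⟨ ∑-mono-≤ pointwise ⟩
    ∑ (λ v → x v ∸ j)               ∎
    where
    open ≤-Reasoning
    j = x′ t
    x′s≤j : x′ s ≤ j
    x′s≤j = ≤-pred (≤-trans (s≤s (≤-reflexive at-s)) (≤-trans 1+xs<xt (≤-reflexive (sym at-t))))
    pointwise : ∀ v → (x′ v ∸ j) + δ t v ≤ x v ∸ j
    pointwise v with s ≟ v | t ≟ v
    ... | yes refl | yes refl = contradiction refl s≢t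
    ... | yes refl | no _     = ≤-trans (≤-reflexive (trans (+-identityʳ _) (m≤n⇒m∸n≡0 x′s≤j))) z≤n
    ... | no _     | yes refl = ≤-reflexive (trans (cong (_+ 1) (n∸n≡0 (x′ t)))
                                  (trans (sym (m+n∸n≡m 1 (x′ t))) (cong (_∸ x′ t) at-t)))
    ... | no s≢v   | no t≢v   = ≤-reflexive (trans (+-identityʳ _) (cong (_∸ j) (elsewhere s≢v t≢v)))

-- Necessity and sufficiency of the criterion

module _ {n m : ℕ} where

  -- The transfer puts `D′` at or below `D`, minimality puts `D` at or below `D′`, so all hinge sums
  -- agree; yet at level `inDegree D′ t` they differ.
  decMin⇒¬improving : ∀ {G : Graph n m} {D} → DecMinAmong (IsStrongOrientation G) D → ¬ ImprovingPair D
  decMin⇒¬improving {G} {D} ((orients , strong) , minimal) (s , t , gap , P , Q , disjoint) =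
    <-irrefl (sym same) (shift-∑-< (inDegree D) (inDegree D′) gap shift)
    where
    open ≡-Reasoning
    D′ = reverseArcs D (arcs (proj₁ P))

    shift : ∀ v → inDegree D′ v + δ t v ≡ inDegree D v + δ s v
    shift v rewrite inDegree-∑ D′ v | inDegree-∑ D v =
      headWeight-reverse (λ u → δ u v) (proj₁ P) (unique-arcs _ (proj₂ P))

    D≤D′ : inDegreeVector D ≤dec inDegreeVector D′
    D≤D′ = minimal D′
      ( Reorients-orientation {G = G} {D} {D′} orients (reverseArcs-Reorients {D = D} (arcs (proj₁ P)))
      , reverse-strong strong P Q disjoint )

    D′≤D : inDegreeVector D′ ≤dec inDegreeVector D
    D′≤D = ≤dec-of-hinges (length-inDegreeVector D′ D) λ j →
      subst₂ _≤_ (sym (hinge-inDegreeVector j D′)) (sym (hinge-inDegreeVector j D))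
        (shift-∑-≤ (inDegree D) (inDegree D′) gap shift j)

    j = inDegree D′ t

    same : ∑ (λ v → inDegree D v ∸ j) ≡ ∑ (λ v → inDegree D′ v ∸ j)
    same = begin
      ∑ (λ v → inDegree D v ∸ j)   ≡⟨ hinge-inDegreeVector j D ⟨
      hinge j (inDegreeVector D)   ≡⟨ ≤dec-antisym-hinge D≤D′ D′≤D j ⟩
      hinge j (inDegreeVector D′)  ≡⟨ hinge-inDegreeVector j D′ ⟩
      ∑ (λ v → inDegree D′ v ∸ j)  ∎

  ¬improving⇒decMin : ∀ {G : Graph n m} {D} → IsStrongOrientation G D → ¬ ImprovingPair D →
    DecMinAmong (IsStrongOrientation G) D
  ¬improving⇒decMin {G} {D} so@(orients , strong) ¬improving =
    so , λ D′ (orients′ , strong′) → ≤dec-of-hinges (length-inDegreeVector D D′)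
      (hinge-≤ strong strong′ (orientations-Reorient {G = G} {D} {D′} orients orients′) ¬improving)

theorem6p1 : ∀ {n m : ℕ} (G : Graph n m) → HasStrongOrientation G →
    (D : Digraph n m) → IsStrongOrientation G D →
    DecMinAmong (IsStrongOrientation G) D ⇔
    (¬ (∃₂ λ s t → inDegree D t ≥ inDegree D s + 2 × ∃₂ λ (P Q : Path D s t) → ArcDisjoint P Q))
theorem6p1 G _ D so = mk⇔ decMin⇒¬improving (¬improving⇒decMin so)
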